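{- Let $n,k,m$ be positive integers with $m\mid k$, $\gcd(m,k/m)=1$ and $\mathrm{rad}(k/m)=\mathrm{rad}(n)>1$. Let $S$ be a sequence of $2n-2$ integers, none of which is divisible by $n$. Then $S$ has no subsequence of length at most $n$ whose sum is divisible by $n$ but not by $nk$ if and only if there exist integers $c,d$ with $c$ coprime to $n$ such that $n-1$ terms of $S$ are congruent to $d\frac{nk}{m}+cm$ modulo $nk$ and the other $n-1$ terms of $S$ are congruent to $-d\frac{nk}{m}-cm$ modulo $nk$. In fact, such a sequence $S$ (i.e. one satisfying these equivalent conditions) has no subsequence (of any length) whose sum is divisible by $n$ but not by $nk$.
   Context: For a positive integer $n$, $\mathrm{rad}(n)=\prod_{p\mid n}p$ is the product of the distinct prime divisors of $n$, with $\mathrm{rad}(1)=1$. Sequences are finite and unordered with repetition allowed (multisets); a subsequence is a sub-multiset, and its length is the number of its terms counted with multiplicity. -}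

module Defs where

open import Data.Nat.Base as ℕ using (ℕ; suc)
open import Data.Nat.Divisibility as ℕ using (_∣?_)
open import Data.Nat.ListAction using (product)
open import Data.Nat.Primality using (prime?)
open import Data.Integer.Base using (ℤ; +_; 0ℤ; _+_; _-_; -_; _*_)
open import Data.Integer.Divisibility.Signed using (_∣_)
open import Data.Integer.Coprimality using (Coprime)
open import Data.List.Base using (List; length; foldr; filter; upTo; _++_)
open import Data.List.Relation.Unary.All using (All)
open import Data.List.Relation.Binary.Permutation.Propositional using (_↭_)
open import Data.Product.Base using (∃-syntax; _×_)
open import Relation.Binary.PropositionalEquality.Core using (_≡_)
open import Relation.Nullary.Decidable.Core using (_×-dec_)
open import Relation.Nullary.Negation.Core using (¬_)

-- upTo (suc n) lists 0, …, n, so for n ≥ 1 every prime divisor of n occurs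
-- exactly once.
rad : ℕ → ℕ
rad n = product (filter (λ p → prime? p ×-dec (p ∣? n)) (upTo (suc n)))

infix 4 _≡_[mod_] _⊑_

_≡_[mod_] : ℤ → ℤ → ℕ → Set
x ≡ y [mod N ] = + N ∣ x - y

sum : List ℤ → ℤ
sum = foldr _+_ 0ℤ

-- A multiset of integers is represented by any list of its terms, lists being
-- compared up to permutation.  T ⊑ S says that T is a sub-multiset of S; the
-- empty one is allowed.
_⊑_ : List ℤ → List ℤ → Set
T ⊑ S = ∃[ U ] T ++ U ↭ S

SumDivisibleByButNotBy : (a b : ℕ) → List ℤ → Set
SumDivisibleByButNotBy a b T = (+ a ∣ sum T) × (¬ (+ b ∣ sum T))

-- T and U together are exactly the terms of S.
HasStructure : (n k m : ℕ) .{{_ : ℕ.NonZero m}} → List ℤ → Set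
HasStructure n k m S =
  ∃[ c ] ∃[ d ] Coprime c (+ n) ×
    (∃[ T ] ∃[ U ] T ++ U ↭ S ×
      length T ≡ n ℕ.∸ 1 ×
      length U ≡ n ℕ.∸ 1 ×
      All (λ x → x ≡ d * + ((n ℕ.* k) ℕ./ m) + c * + m [mod n ℕ.* k ]) T ×
      All (λ x → x ≡ (- d) * + ((n ℕ.* k) ℕ./ m) - c * + m [mod n ℕ.* k ]) U)

{-# OPTIONS --safe #-}

-- A sequence T with n ∣ sum T and length T > n splits into two shorter ones of the same
-- kind, so the length bound may be dropped: call S admissible if n ∣ sum T implies
-- nk ∣ sum T for all T ⊑ S.  Since every prime divisor of n divides k, every x not
-- divisible by n has a multiple divisible by n but not by nk.  Hence, if the subsequence
-- sums of R are determined modulo nk by their residues modulo n, each term of R adds a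
-- new residue, and R has at most n − 1 terms.  This applies to R as soon as the sums of
-- the other terms of S cover all residues modulo n.  Choosing those other terms
-- greedily, one gains a residue per term unless the remaining terms have a common
-- divisor with n, which induction on n excludes; so an admissible S has at most 2n − 2
-- terms.  If S has exactly 2n − 2 terms, no start of the greedy choice may gain more:
-- two terms x, y never give four residues 0, x, y, x + y, which means y ≡ ± x modulo n.
-- Neither sign occurs n times: those terms would all be congruent to one z modulo nk, and
-- nk ∣ nz contradicts z being coprime to n.
module Submission where

open import Defs
open import Data.Nat.Base using (ℕ; NonZero; _*_; _∸_; _/_; _≤_; _>_)
open import Data.Nat.Divisibility using (_∣_)
open import Data.Nat.GCD using (gcd)
open import Data.Integer.Base using (ℤ; +_)
open import Data.Integer.Divisibility.Signed using () renaming (_∣_ to _∣ℤ_)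
open import Data.List.Base using (List; length)
open import Data.List.Relation.Unary.All using (All)
open import Data.Product.Base using (∃-syntax; _×_)
open import Function.Bundles using (_⇔_)
open import Relation.Binary.PropositionalEquality.Core using (_≡_)
open import Relation.Nullary.Negation.Core using (¬_)

open import Data.Fin.Base as Fin using (Fin; zero; suc)
import Data.Fin.Properties as Fin
import Data.Integer.Base as ℤ
open import Data.Integer.Coprimality using () renaming (Coprime to ℤCoprime)
open import Data.Integer.Divisibility.Signed as ℤ∣ using (divides)
open import Data.Integer.DivMod using (_%ℕ_; _/ℕ_; n%ℕd<d; a≡a%ℕn+[a/ℕn]*n)
import Data.Integer.Properties as ℤ
open import Data.Integer.Tactic.RingSolver using (solve-∀)
open import Data.List.Base using ([]; _∷_; [_]; _++_; lookup; map; foldr; take; drop; upTo)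
open import Data.List.Membership.Propositional using (_∈_; find; lose)
open import Data.List.Membership.Propositional.Properties
  using (∈-lookup; ∈-∃++; ∈-++⁻; ∈-filter⁺; ∈-filter⁻; ∈-upTo⁺)
open import Data.List.Properties
  using (map-++; length-map; length-++; length-take; take++drop≡id; ++-conicalˡ)
open import Data.List.Relation.Binary.Permutation.Propositional
  using (_↭_; ↭-refl; ↭-sym; ↭-trans; ↭-reflexive; ↭⇒↭ₛ; prep; swap)
import Data.List.Relation.Binary.Permutation.Propositional.Properties as ↭
open import Data.List.Relation.Binary.Permutation.Setoid.Properties
  using (foldr-commMonoid)
open import Data.List.Relation.Unary.All using ([]; _∷_; all?)
import Data.List.Relation.Unary.All as All
open import Data.List.Relation.Unary.All.Properties using (¬Any⇒All¬; map⁻; take⁺; all-filter)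
open import Data.List.Relation.Unary.AllPairs using (AllPairs; []; _∷_)
open import Data.List.Relation.Unary.Any using (here; there; any?)
import Data.Nat.Base as ℕ
open import Data.Nat.Coprimality as Coprime using (Coprime; coprime-divisor)
import Data.Nat.Divisibility as ℕ∣
open import Data.Nat.GCD using (gcd[m,n]∣m; gcd[m,n]∣n; gcd-GCD; gcd[m,n]≢0; module Bézout)
open import Data.Nat.DivMod using (m/n*n≡m; *-/-assoc)
open import Data.Nat.Induction using (<-wellFounded; <-rec)
open import Induction.WellFounded using (Acc; acc)
open import Data.Nat.ListAction using (product)
open import Data.Nat.ListAction.Properties using (∈⇒∣product)
open import Data.Nat.Primality using (Prime; prime?; ¬prime[1])
open import Data.Nat.Primality.Factorisation using (factorise; factorisationHasAllPrimeFactors)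
import Data.Nat.Properties as ℕ
open import Data.Product.Base using (_,_; proj₁; proj₂; ∃₂)
open import Data.Sum.Base using (_⊎_; inj₁; inj₂)
open import Data.Empty using (⊥; ⊥-elim)
open import Function.Base using (_∘_)
open import Function.Bundles using (mk⇔)
open import Relation.Binary.PropositionalEquality
  using (refl; sym; trans; cong; cong₂; subst; subst₂; setoid; module ≡-Reasoning)
open import Relation.Nullary.Decidable using (map′; _×-dec_)
open import Relation.Nullary using (Dec; yes; no; contradiction; ¬?)

private variable
  N n k d : ℕ
  w x y z : ℤ
  B C R S T U : List ℤ

-- Congruences

-- The definition _≡_[mod_] unfolds to a divisibility from which x and y cannot
-- be inferred.
record _≈_[_] (x y : ℤ) (N : ℕ) : Set where
  constructor mod
  field ∣-diff : x ≡ y [mod N ]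

open _≈_[_] using (∣-diff)

infix 4 _≈_[_] _≈?_[_]

_≈?_[_] : (x y : ℤ) (N : ℕ) → Dec (x ≈ y [ N ])
x ≈? y [ N ] = map′ mod ∣-diff (+ N ℤ∣.∣? x ℤ.- y)

≈-reflexive : x ≡ y → x ≈ y [ N ]
≈-reflexive {x} refl = mod (divides ℤ.0ℤ (ℤ.+-inverseʳ x))

≈-refl : x ≈ x [ N ]
≈-refl = ≈-reflexive refl

≈-sym : x ≈ y [ N ] → y ≈ x [ N ]
≈-sym {x} {y} (mod p) = mod (subst (_ ∣ℤ_) (eq x y) (ℤ∣.∣m⇒∣-m p))
  where
  eq : ∀ x y → ℤ.- (x ℤ.- y) ≡ y ℤ.- x
  eq = solve-∀

≈-trans : x ≈ y [ N ] → y ≈ z [ N ] → x ≈ z [ N ]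
≈-trans {x} {y} {z = z} (mod p) (mod q) = mod (subst (_ ∣ℤ_) (eq x y z) (ℤ∣.∣m∣n⇒∣m+n p q))
  where
  eq : ∀ x y z → (x ℤ.- y) ℤ.+ (y ℤ.- z) ≡ x ℤ.- z
  eq = solve-∀

≈-+ : w ≈ x [ N ] → y ≈ z [ N ] → w ℤ.+ y ≈ x ℤ.+ z [ N ]
≈-+ {w} {x} {y = y} {z} (mod p) (mod q) = mod (subst (_ ∣ℤ_) (eq w x y z) (ℤ∣.∣m∣n⇒∣m+n p q))
  where
  eq : ∀ w x y z → (w ℤ.- x) ℤ.+ (y ℤ.- z) ≡ (w ℤ.+ y) ℤ.- (x ℤ.+ z)
  eq = solve-∀

≈-neg : x ≈ y [ N ] → ℤ.- x ≈ ℤ.- y [ N ]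
≈-neg {x} {y} (mod p) = mod (subst (_ ∣ℤ_) (eq x y) (ℤ∣.∣m⇒∣-m p))
  where
  eq : ∀ x y → ℤ.- (x ℤ.- y) ≡ ℤ.- x ℤ.- ℤ.- y
  eq = solve-∀

≈-weaken : n ∣ N → x ≈ y [ N ] → x ≈ y [ n ]
≈-weaken n∣N (mod p) = mod (ℤ∣.∣-trans (ℤ∣.∣ᵤ⇒∣ n∣N) p)

∣⇒≈0 : + N ∣ℤ x → x ≈ ℤ.0ℤ [ N ]
∣⇒≈0 {x = x} N∣x = mod (subst (_ ∣ℤ_) (sym (ℤ.+-identityʳ x)) N∣x)

≈0⇒∣ : x ≈ ℤ.0ℤ [ N ] → + N ∣ℤ x
≈0⇒∣ {x} (mod p) = subst (_ ∣ℤ_) (ℤ.+-identityʳ x) p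

≈-∣ : x ≈ y [ N ] → + N ∣ℤ y → + N ∣ℤ x
≈-∣ x≈y N∣y = ≈0⇒∣ (≈-trans x≈y (∣⇒≈0 N∣y))

+-∣-≈ : ∀ c {z} → + N ∣ℤ z → c ℤ.+ z ≈ c [ N ]
+-∣-≈ c N∣z = ≈-trans (≈-+ (≈-refl {c}) (∣⇒≈0 N∣z)) (≈-reflexive (ℤ.+-identityʳ c))

+-≈⇒∣ : ∀ c {z} → c ℤ.+ z ≈ c [ N ] → + N ∣ℤ z
+-≈⇒∣ c {z} (mod p) = subst (_ ∣ℤ_) (eq c z) p
  where
  eq : ∀ c z → (c ℤ.+ z) ℤ.- c ≡ z
  eq = solve-∀

%ℕ-cong⁻¹ : .{{_ : NonZero N}} → x %ℕ N ≡ y %ℕ N → x ≈ y [ N ]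
%ℕ-cong⁻¹ {N} {x} {y} eq = mod (divides (x /ℕ N ℤ.- y /ℕ N) (begin
  x ℤ.- y
    ≡⟨ cong₂ ℤ._-_ (a≡a%ℕn+[a/ℕn]*n x N) (a≡a%ℕn+[a/ℕn]*n y N) ⟩
  (+ (x %ℕ N) ℤ.+ x /ℕ N ℤ.* + N) ℤ.- (+ (y %ℕ N) ℤ.+ y /ℕ N ℤ.* + N)
    ≡⟨ cong (λ r → (+ (x %ℕ N) ℤ.+ x /ℕ N ℤ.* + N) ℤ.- (+ r ℤ.+ y /ℕ N ℤ.* + N)) (sym eq) ⟩
  (+ (x %ℕ N) ℤ.+ x /ℕ N ℤ.* + N) ℤ.- (+ (x %ℕ N) ℤ.+ y /ℕ N ℤ.* + N)
    ≡⟨ cancel (+ (x %ℕ N)) (x /ℕ N) (y /ℕ N) (+ N) ⟩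
  (x /ℕ N ℤ.- y /ℕ N) ℤ.* + N ∎))
  where
  open ≡-Reasoning
  cancel : ∀ r p q m → (r ℤ.+ p ℤ.* m) ℤ.- (r ℤ.+ q ℤ.* m) ≡ (p ℤ.- q) ℤ.* m
  cancel = solve-∀

-- Such a list encodes a set of residues with one representative each, so that `length` is its size.
-- The representatives stay integers because they are later compared modulo `n * k` as well.
Incongruent : ℕ → List ℤ → Set
Incongruent N = AllPairs (λ x y → ¬ x ≈ y [ N ])

AllPairs-lookup : ∀ {A : Set} {_~_ : A → A → Set} {xs} → AllPairs _~_ xs →
                  ∀ {i j} → i Fin.< j → lookup xs i ~ lookup xs j
AllPairs-lookup (x~xs ∷ _) {zero}  {suc j} _           = All.lookup x~xs (∈-lookup j)
AllPairs-lookup (_ ∷ xs~)  {suc i} {suc j} (ℕ.s≤s i<j) = AllPairs-lookup xs~ i<j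

incongruent⇒length≤ : .{{_ : NonZero N}} → Incongruent N B → length B ≤ N
incongruent⇒length≤ {N} {B} inc with length B ℕ.≤? N
... | yes ≤N = ≤N
... | no ≰N
  with i , j , i<j , eq ← Fin.pigeonhole (ℕ.≰⇒> ≰N) (λ i → Fin.fromℕ< (n%ℕd<d (lookup B i) N))
  = contradiction (%ℕ-cong⁻¹ {x = lookup B i} {lookup B j} (Fin.fromℕ<-injective _ _ _ _ eq)) (AllPairs-lookup inc i<j)

incongruent⇒unique : Incongruent N B → x ∈ B → y ∈ B → x ≈ y [ N ] → x ≡ y
incongruent⇒unique _         (here refl) (here refl) _   = refl
incongruent⇒unique (x≢ ∷ _)  (here refl) (there y∈)  x≡y = contradiction x≡y (All.lookup x≢ y∈)
incongruent⇒unique (y≢ ∷ _)  (there x∈)  (here refl) x≡y =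
  contradiction (≈-sym x≡y) (All.lookup y≢ x∈)
incongruent⇒unique (_ ∷ inc) (there x∈)  (there y∈)  x≡y = incongruent⇒unique inc x∈ y∈ x≡y

-- Sets of residues closed under a translation

-- The `z` with this property form the stabiliser of the set of residues of `B`. The `closed-`
-- lemmas show that it is a subgroup containing `N`.
ShiftClosed : ℕ → List ℤ → ℤ → Set
ShiftClosed N B z = ∀ {b} → b ∈ B → ∃[ b′ ] b′ ∈ B × b ℤ.+ z ≈ b′ [ N ]

NewBy : ℕ → List ℤ → ℤ → ℤ → Set
NewBy N B x b = All (λ b′ → ¬ b ℤ.+ x ≈ b′ [ N ]) B

-- The dichotomy behind the greedy choice: a term either enlarges the set of residues or is a period
-- of it.
new⊎closed : ∀ N B x → (∃[ b ] b ∈ B × NewBy N B x b) ⊎ ShiftClosed N B x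
new⊎closed N B x with any? (λ b → all? (λ b′ → ¬? (b ℤ.+ x ≈? b′ [ N ])) B) B
... | yes new = inj₁ (find new)
... | no ¬new = inj₂ closed
  where
  closed : ShiftClosed N B x
  closed {b} b∈ with any? (λ b′ → b ℤ.+ x ≈? b′ [ N ]) B
  ... | yes hit = find hit
  ... | no ¬hit = contradiction (lose b∈ (¬Any⇒All¬ B ¬hit)) ¬new

closed-cong : z ≈ w [ N ] → ShiftClosed N B z → ShiftClosed N B w
closed-cong z≡w closed {b} b∈ with b′ , b′∈ , p ← closed b∈ =
  b′ , b′∈ , ≈-trans (≈-+ (≈-refl {b}) (≈-sym z≡w)) p

closed-+ : ShiftClosed N B z → ShiftClosed N B w → ShiftClosed N B (z ℤ.+ w)
closed-+ {z = z} {w} cz cw {b} b∈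
  with b₁ , b₁∈ , p ← cz b∈
  with b₂ , b₂∈ , q ← cw b₁∈
  = b₂ , b₂∈ , ≈-trans (≈-reflexive (sym (ℤ.+-assoc b z w)))
                 (≈-trans (≈-+ p (≈-refl {w})) q)

closed-modulus : ∀ B → ShiftClosed N B (+ N)
closed-modulus {N} _ {b} b∈ = b , b∈ , mod (divides (+ 1) (eq b (+ N)))
  where
  eq : ∀ b m → b ℤ.+ m ℤ.- b ≡ + 1 ℤ.* m
  eq = solve-∀

closed-* : ∀ j → ShiftClosed N B z → ShiftClosed N B (+ j ℤ.* z)
closed-* {z = z} ℕ.zero    cz {b} b∈ = b , b∈ , ≈-reflexive (ℤ.+-identityʳ b)
closed-* {N} {B} {z} (ℕ.suc j) cz =
  subst (ShiftClosed N B) (sym (ℤ.suc-* (+ j) z)) (closed-+ cz (closed-* j cz))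

-- Modulo `N`, the shift by -z is the (N - 1)-fold shift by z.
closed-neg : .{{_ : NonZero N}} → ShiftClosed N B z → ShiftClosed N B (ℤ.- z)
closed-neg {ℕ.suc N} {z = z} cz = closed-cong (mod (divides z (eq (+ N) z))) (closed-* N cz)
  where
  eq : ∀ m z → m ℤ.* z ℤ.- ℤ.- z ≡ z ℤ.* (+ 1 ℤ.+ m)
  eq = solve-∀

closed-abs : .{{_ : NonZero N}} → ShiftClosed N B z → ShiftClosed N B (+ ℤ.∣ z ∣)
closed-abs {z = + _}        cz = cz
closed-abs {z = ℤ.-[1+ _ ]} cz = closed-neg cz

-- Bézout's identity and greatest common divisors

pos-linear : ∀ g y b x a → g ℕ.+ y * b ≡ x * a → + g ℤ.+ + y ℤ.* + b ≡ + x ℤ.* + a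
pos-linear g y b x a eq =
  trans (cong (λ t → + g ℤ.+ t) (sym (ℤ.pos-* y b))) (trans (cong +_ eq) (ℤ.pos-* x a))

bézout : ∀ a b → ∃₂ λ u v → + gcd a b ≡ u ℤ.* + a ℤ.+ v ℤ.* + b
bézout a b with Bézout.identity (gcd-GCD a b)
... | Bézout.+- x y eq = + x , ℤ.- + y , (begin
    + gcd a b
      ≡⟨ move (+ gcd a b) (+ y) (+ b) ⟩
    (+ gcd a b ℤ.+ + y ℤ.* + b) ℤ.+ (ℤ.- + y) ℤ.* + b
      ≡⟨ cong (ℤ._+ (ℤ.- + y) ℤ.* + b) (pos-linear (gcd a b) y b x a eq) ⟩
    + x ℤ.* + a ℤ.+ (ℤ.- + y) ℤ.* + b ∎)
  where
  open ≡-Reasoning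
  move : ∀ g y b → g ≡ (g ℤ.+ y ℤ.* b) ℤ.+ (ℤ.- y) ℤ.* b
  move = solve-∀
... | Bézout.-+ x y eq = ℤ.- + x , + y , (begin
    + gcd a b
      ≡⟨ move (+ gcd a b) (+ x) (+ a) ⟩
    (ℤ.- + x) ℤ.* + a ℤ.+ (+ gcd a b ℤ.+ + x ℤ.* + a)
      ≡⟨ cong (λ t → (ℤ.- + x) ℤ.* + a ℤ.+ t) (pos-linear (gcd a b) x a y b eq) ⟩
    (ℤ.- + x) ℤ.* + a ℤ.+ + y ℤ.* + b ∎)
  where
  open ≡-Reasoning
  move : ∀ g x a → g ≡ (ℤ.- x) ℤ.* a ℤ.+ (g ℤ.+ x ℤ.* a)
  move = solve-∀

closed-*ℤ : .{{_ : NonZero N}} → ∀ u → ShiftClosed N B z → ShiftClosed N B (u ℤ.* z)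
closed-*ℤ (+ j)                 cz = closed-* j cz
closed-*ℤ {N} {B} {z} ℤ.-[1+ j ] cz =
  subst (ShiftClosed N B) (ℤ.neg-distribˡ-* (+ ℕ.suc j) z) (closed-neg (closed-* (ℕ.suc j) cz))

closed-any : .{{_ : NonZero N}} → ShiftClosed N B (+ 1) → ∀ z → ShiftClosed N B z
closed-any {N} {B} c1 z = subst (ShiftClosed N B) (ℤ.*-identityʳ z) (closed-*ℤ z c1)

closed-gcd : .{{_ : NonZero N}} → ∀ a b →
             ShiftClosed N B (+ a) → ShiftClosed N B (+ b) → ShiftClosed N B (+ gcd a b)
closed-gcd {N} {B} a b ca cb with u , v , eq ← bézout a b =
  subst (ShiftClosed N B) (sym eq) (closed-+ (closed-*ℤ u ca) (closed-*ℤ v cb))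

-- Starting the fold at `n` makes the result a divisor of `n`, as the descent from `n` to a proper
-- divisor requires.
gcds : ℕ → List ℤ → ℕ
gcds n = foldr (λ x d → gcd ℤ.∣ x ∣ d) n

gcds∣ : ∀ n R → gcds n R ∣ n
gcds∣ n []      = ℕ∣.∣-refl
gcds∣ n (x ∷ R) = ℕ∣.∣-trans (gcd[m,n]∣n ℤ.∣ x ∣ (gcds n R)) (gcds∣ n R)

gcds∣all : ∀ n R → All (λ x → + gcds n R ∣ℤ x) R
gcds∣all n []      = []
gcds∣all n (x ∷ R) =
  ℤ∣.∣ᵤ⇒∣ (gcd[m,n]∣m ℤ.∣ x ∣ (gcds n R)) ∷
  All.map (ℤ∣.∣-trans (ℤ∣.∣ᵤ⇒∣ (gcd[m,n]∣n ℤ.∣ x ∣ (gcds n R)))) (gcds∣all n R)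

-- By Bézout, a subgroup containing `n` and all terms of `R` contains their greatest common divisor.
closed-gcds : .{{_ : NonZero n}} → All (ShiftClosed n B) R → ShiftClosed n B (+ gcds n R)
closed-gcds {B = B} []     = closed-modulus B
closed-gcds {n} {R = x ∷ R} (cx ∷ cR) =
  closed-gcd ℤ.∣ x ∣ (gcds n R) (closed-abs cx) (closed-gcds cR)
-- Subsequence sums

⊑-[] : [] ⊑ S
⊑-[] {S} = S , ↭-refl

⊑-keep : T ⊑ S → x ∷ T ⊑ x ∷ S
⊑-keep {x = x} (U , p) = U , prep x p

⊑-skip : T ⊑ S → T ⊑ x ∷ S
⊑-skip {T} {x = x} (U , p) = x ∷ U , ↭-trans (↭.shift x T U) (prep x p)

⊑-resp-↭ : R ↭ S → T ⊑ R → T ⊑ S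
⊑-resp-↭ R↭S (U , p) = U , ↭-trans p R↭S

⊑-trans : R ⊑ T → T ⊑ S → R ⊑ S
⊑-trans {R} (U , p) (V , q) =
  U ++ V , ↭-trans (↭-sym (↭.++-assoc R U V)) (↭-trans (↭.++⁺ʳ V p) q)

map-⊑ : ∀ {f} → T ⊑ S → map f T ⊑ map f S
map-⊑ {T} {f = f} (U , p) = map f U , ↭-trans (↭-reflexive (sym (map-++ f T U))) (↭.map⁺ f p)

Reach : List ℤ → List ℤ → ℤ → Set
Reach B R z = ∃₂ λ b X → b ∈ B × X ⊑ R × z ≡ b ℤ.+ sum X

reach-∈ : z ∈ B → Reach B R z
reach-∈ {z} z∈ = z , [] , z∈ , ⊑-[] , sym (ℤ.+-identityʳ z)

reach-+ : z ∈ B → Reach B (x ∷ R) (z ℤ.+ x)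
reach-+ {z} {x = x} z∈ = z , x ∷ [] , z∈ , ⊑-keep ⊑-[] , cong (λ t → z ℤ.+ t) (sym (ℤ.+-identityʳ x))

reach-resp-↭ : R ↭ S → Reach B R z → Reach B S z
reach-resp-↭ p (b , X , b∈ , X⊑ , eq) = b , X , b∈ , ⊑-resp-↭ p X⊑ , eq

reach-absorb : y ∈ B → Reach (y ℤ.+ x ∷ B) R z → Reach B (x ∷ R) z
reach-absorb {y} {x = x} y∈ (_ , X , here refl , X⊑ , eq) =
  y , x ∷ X , y∈ , ⊑-keep X⊑ , trans eq (ℤ.+-assoc y x (sum X))
reach-absorb _ (b , X , there b∈ , X⊑ , eq) = b , X , b∈ , ⊑-skip X⊑ , eq

reach-translate : y ∈ B → Reach [ ℤ.0ℤ ] R z → Reach B R (y ℤ.+ z)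
reach-translate {y} y∈ (_ , X , here refl , X⊑ , eq) =
  y , X , y∈ , X⊑ , cong (λ t → y ℤ.+ t) (trans eq (ℤ.+-identityˡ (sum X)))

-- Equivalent to "every prime dividing n divides k".
NoCoprimeDivisor : ℕ → ℕ → Set
NoCoprimeDivisor n k = ∀ {j} → j ∣ n → Coprime j k → j ≡ 1

-- With g = gcd(|x|, n), take j = n/g, so that |jx| = n · |x|/g. If nk divided this, k would divide
-- |x|/g, which is coprime to j. Then j is coprime to k, whence j = 1, g = n and n divides x.
multiple-escapes : .{{_ : NonZero n}} → NoCoprimeDivisor n k → ¬ + n ∣ℤ x →
                   ∃[ j ] + n ∣ℤ + j ℤ.* x × ¬ + (n * k) ∣ℤ + j ℤ.* x
multiple-escapes {n} {k} {x} nocop n∤x = j , n∣jx , nk∤jx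
  where
  instance
    g≢0 : NonZero (gcd ℤ.∣ x ∣ n)
    g≢0 = ℕ.≢-nonZero (gcd[m,n]≢0 ℤ.∣ x ∣ n (inj₂ (ℕ.≢-nonZero⁻¹ n)))
  g = gcd ℤ.∣ x ∣ n
  a = ℤ.∣ x ∣ / g
  j = n / g
  ag≡ : a * g ≡ ℤ.∣ x ∣
  ag≡ = m/n*n≡m (gcd[m,n]∣m ℤ.∣ x ∣ n)
  jg≡ : j * g ≡ n
  jg≡ = m/n*n≡m (gcd[m,n]∣n ℤ.∣ x ∣ n)
  jx≡ : ℤ.∣ + j ℤ.* x ∣ ≡ n * a
  jx≡ = begin
    ℤ.∣ + j ℤ.* x ∣  ≡⟨ ℤ.abs-* (+ j) x ⟩
    j * ℤ.∣ x ∣      ≡⟨ cong (j *_) (trans (ℕ.*-comm g a) ag≡) ⟨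
    j * (g * a)      ≡⟨ ℕ.*-assoc j g a ⟨
    j * g * a        ≡⟨ cong (_* a) jg≡ ⟩
    n * a            ∎
    where open ≡-Reasoning
  n∣jx : + n ∣ℤ + j ℤ.* x
  n∣jx = ℤ∣.∣ᵤ⇒∣ (subst (n ∣_) (sym jx≡) (ℕ∣.m∣m*n a))
  nk∤jx : ¬ + (n * k) ∣ℤ + j ℤ.* x
  nk∤jx nk∣jx = n∤x (ℤ∣.∣ᵤ⇒∣ (subst (_∣ ℤ.∣ x ∣) g≡n (gcd[m,n]∣m ℤ.∣ x ∣ n)))
    where
    k∣a : k ∣ a
    k∣a = ℕ∣.*-cancelˡ-∣ n (subst (n * k ∣_) jx≡ (ℤ∣.∣⇒∣ᵤ nk∣jx))
    j≡1 : j ≡ 1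
    j≡1 = nocop (ℕ∣.divides g (trans (sym jg≡) (ℕ.*-comm j g)))
            (λ (d∣j , d∣k) → Coprime.coprime-/gcd ℤ.∣ x ∣ n (ℕ∣.∣-trans d∣k k∣a , d∣j))
    g≡n : g ≡ n
    g≡n = trans (sym (ℕ.*-identityˡ g)) (trans (cong (_* g) (sym j≡1)) jg≡)

-- A shift by a multiple of `n` keeps the residue of `x` modulo `n`, and `C` has only one
-- representative of it. So the shift sends `x` to itself even modulo `N`.
closed-divisible : Incongruent n C → x ∈ C → n ∣ N → ShiftClosed N C z → + n ∣ℤ z → + N ∣ℤ z
closed-divisible {x = x} {N} {z} inc x∈ n∣N closed n∣z
  with y , y∈ , p ← closed x∈
  = +-≈⇒∣ x (subst (λ t → x ℤ.+ z ≈ t [ N ]) (sym x≡y) p)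
  where
  x≡y : x ≡ y
  x≡y = incongruent⇒unique inc x∈ y∈ (≈-trans (≈-sym (+-∣-≈ x n∣z)) (≈-weaken n∣N p))

-- If a term x gives no new residue modulo n, then C + x = C already modulo nk, so C is
-- closed under all multiples of x, one of which is divisible by n but not by nk.
length-injective : .{{_ : NonZero n}} → NoCoprimeDivisor n k → ∀ R C → x ∈ C → Incongruent n C →
  (∀ {z w} → Reach C R z → Reach C R w → z ≈ w [ n ] → z ≈ w [ n * k ]) →
  All (λ y → ¬ + n ∣ℤ y) R → length R ℕ.+ length C ≤ n
length-injective nocop []      C _  inc _   _ = incongruent⇒length≤ inc
length-injective {n} {k} nocop (x ∷ R) C c∈ inc inj (n∤x ∷ n∤R) with new⊎closed n C x
... | inj₁ (b , b∈ , new) = subst (_≤ n) (ℕ.+-suc (length R) (length C))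
  (length-injective nocop R (b ℤ.+ x ∷ C) (here refl) (new ∷ inc)
    (λ p q → inj (reach-absorb b∈ p) (reach-absorb b∈ q)) n∤R)
... | inj₂ closed =
  let j , n∣jx , nk∤jx = multiple-escapes {x = x} nocop n∤x
  in contradiction (closed-divisible inc c∈ (ℕ∣.m∣m*n k) (closed-* j closed′) n∣jx) nk∤jx
  where
  closed′ : ShiftClosed (n * k) C x
  closed′ b∈ = let b′ , b′∈ , p = closed b∈ in b′ , b′∈ , inj (reach-+ b∈) (reach-∈ b′∈) p

-- The length of admissible sequences

Admissible : ℕ → ℕ → List ℤ → Set
Admissible n k S = ∀ {T} → T ⊑ S → + n ∣ℤ sum T → + (n * k) ∣ℤ sum T

-- The induction runs over `n` with `k` fixed, hence the order of the arguments. The 1 added to the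
-- length counts the empty sum, the only element of `B` when the greedy choice starts.
Bounded : ℕ → ℕ → Set
Bounded k n = .{{_ : NonZero n}} → NoCoprimeDivisor n k → ∀ R → All (λ x → ¬ + n ∣ℤ x) R →
              Admissible n k R → 2 * n ≤ length R ℕ.+ 1 → ⊥

quotients : All (+ d ∣ℤ_) R → ∃[ Q ] R ≡ map (ℤ._* + d) Q
quotients []                      = [] , refl
quotients (divides q eq ∷ ds) with Q , refl ← quotients ds = q ∷ Q , cong (_∷ _) eq

sum-map-* : ∀ z T → sum (map (ℤ._* z) T) ≡ sum T ℤ.* z
sum-map-* z []      = refl
sum-map-* z (x ∷ T) = trans (cong (λ t → x ℤ.* z ℤ.+ t) (sum-map-* z T)) (sym (ℤ.*-distribʳ-+ z x (sum T)))

∣⇒*∣* : ∀ d → + n ∣ℤ x → + (n * d) ∣ℤ x ℤ.* + d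
∣⇒*∣* {n} {x} d n∣x = subst (_∣ℤ x ℤ.* + d) (sym (ℤ.pos-* n d)) (ℤ∣.*-monoˡ-∣ (+ d) n∣x)

*∣*⇒∣ : ∀ d .{{_ : NonZero d}} → + (n * d) ∣ℤ x ℤ.* + d → + n ∣ℤ x
*∣*⇒∣ {n} {x} d nd∣xd = ℤ∣.*-cancelʳ-∣ (+ d) (subst (_∣ℤ x ℤ.* + d) (ℤ.pos-* n d) nd∣xd)

-- If d > 1, dividing all terms by d gives an admissible sequence for n/d and the same `k`. It has
-- at least n ≥ 2(n/d) terms, too many by the induction hypothesis.
no-common-divisor : .{{_ : NonZero n}} → (∀ {n′} → n′ ℕ.< n → Bounded k n′) → NoCoprimeDivisor n k →
  All (λ x → ¬ + n ∣ℤ x) R → Admissible n k R → n ≤ length R →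
  d ∣ n → All (+ d ∣ℤ_) R → d ≡ 1
no-common-divisor {d = 1} _ _ _ _ _ _ _ = refl
no-common-divisor {n} {k} {d = 0} _ _ _ _ _ 0∣n _ = contradiction (ℕ∣.0∣⇒≡0 0∣n) (ℕ.≢-nonZero⁻¹ n)
no-common-divisor {n} {k} {R} {d = d@(ℕ.suc (ℕ.suc _))} bounded nocop n∤R adm n≤ (ℕ∣.divides n′ refl) d∣R
  with Q , refl ← quotients d∣R
  = ⊥-elim (bounded (ℕ.m<m*n n′ d 1<d) (λ j∣ → nocop (ℕ∣.∣m⇒∣m*n d j∣)) Q n′∤Q adm′ 2n′≤)
  where
  instance
    n′≢0 : NonZero n′
    n′≢0 = ℕ.m*n≢0⇒m≢0 n′ {d}
  1<d : 1 ℕ.< d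
  1<d = ℕ.s≤s (ℕ.s≤s ℕ.z≤n)
  n′∤Q : All (λ x → ¬ + n′ ∣ℤ x) Q
  n′∤Q = All.map (λ nd∤ n∣ → nd∤ (∣⇒*∣* d n∣)) (map⁻ n∤R)
  adm′ : Admissible n′ k Q
  adm′ {T} T⊑Q n′∣ = *∣*⇒∣ d (subst₂ (λ N s → + N ∣ℤ s) nk≡ (sum-map-* (+ d) T)
    (adm (map-⊑ T⊑Q) (subst (+ n ∣ℤ_) (sym (sum-map-* (+ d) T)) (∣⇒*∣* d n′∣))))
    where
    nk≡ : n′ * d * k ≡ n′ * k * d
    nk≡ = trans (ℕ.*-assoc n′ d k) (trans (cong (n′ *_) (ℕ.*-comm d k)) (sym (ℕ.*-assoc n′ k d)))
  2n′≤ : 2 * n′ ≤ length Q ℕ.+ 1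
  2n′≤ = begin
    2 * n′                    ≡⟨ ℕ.*-comm 2 n′ ⟩
    n′ * 2                    ≤⟨ ℕ.*-monoʳ-≤ n′ 1<d ⟩
    n                         ≤⟨ n≤ ⟩
    length (map (ℤ._* + d) Q) ≡⟨ length-map (ℤ._* + d) Q ⟩
    length Q                  ≤⟨ ℕ.m≤m+n _ 1 ⟩
    length Q ℕ.+ 1            ∎
    where open ℕ.≤-Reasoning

pick-new : ∀ N B R → (∃[ R′ ] ∃[ x ] ∃[ b ] x ∷ R′ ↭ R × b ∈ B × NewBy N B x b) ⊎
                     All (ShiftClosed N B) R
pick-new N B []      = inj₂ []
pick-new N B (x ∷ R) with new⊎closed N B x
... | inj₁ (b , b∈ , new) = inj₁ (R , x , b , ↭-refl , b∈ , new)
... | inj₂ closed with pick-new N B R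
...   | inj₁ (R′ , y , b , p , b∈ , new) =
  inj₁ (x ∷ R′ , y , b , ↭-trans (swap y x ↭-refl) (prep x p) , b∈ , new)
...   | inj₂ closeds = inj₂ (closed ∷ closeds)

-- If B covers all residues modulo n, then sums over R that agree modulo n can be
-- completed by the same b ∈ B to multiples of n, so they agree modulo nk.
full⇒length< : .{{_ : NonZero n}} → NoCoprimeDivisor n k → ShiftClosed n B (+ 1) → ℤ.0ℤ ∈ B →
  (∀ {z} → Reach B R z → + n ∣ℤ z → + (n * k) ∣ℤ z) →
  All (λ x → ¬ + n ∣ℤ x) R → length R ℕ.< n
full⇒length< {n} {k} {B} {R} nocop closed1 0∈ lift n∤R =
  subst (_≤ n) (ℕ.+-comm (length R) 1)
    (length-injective nocop R [ ℤ.0ℤ ] (here refl) ([] ∷ []) injective n∤R)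
  where
  injective : ∀ {z w} → Reach [ ℤ.0ℤ ] R z → Reach [ ℤ.0ℤ ] R w → z ≈ w [ n ] → z ≈ w [ n * k ]
  injective {z} {w} pz pw z≈w with b , b∈ , p ← closed-any closed1 (ℤ.- z) 0∈ =
    mod (subst (_ ∣ℤ_) (cancel b z w) (ℤ∣.∣m∣n⇒∣m-n
      (lift (reach-translate b∈ pz) n∣b+z)
      (lift (reach-translate b∈ pw) (≈-∣ (≈-+ (≈-refl {b}) (≈-sym z≈w)) n∣b+z))))
    where
    cancel : ∀ b z w → (b ℤ.+ z) ℤ.- (b ℤ.+ w) ≡ z ℤ.- w
    cancel = solve-∀
    n∣b+z : + n ∣ℤ b ℤ.+ z
    n∣b+z = ≈0⇒∣ (≈-trans (≈-+ (≈-sym p) (≈-refl {z})) (≈-reflexive (neg-cancel z)))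
      where
      neg-cancel : ∀ z → (ℤ.0ℤ ℤ.+ ℤ.- z) ℤ.+ z ≡ ℤ.0ℤ
      neg-cancel = solve-∀

-- When no term of R produces a new residue, B is periodic modulo the gcd of n and R.
no-large-reach : .{{_ : NonZero n}} → (∀ {n′} → n′ ℕ.< n → Bounded k n′) → NoCoprimeDivisor n k →
  ∀ R B → Acc ℕ._<_ (length R) → ℤ.0ℤ ∈ B → Incongruent n B →
  (∀ {z} → Reach B R z → + n ∣ℤ z → + (n * k) ∣ℤ z) →
  All (λ x → ¬ + n ∣ℤ x) R → 2 * n ≤ length R ℕ.+ length B → ⊥
no-large-reach {n} {k} bounded nocop R B (acc rec) 0∈ inc lift n∤R 2n≤ with pick-new n B R
... | inj₁ (R′ , x , b , p , b∈ , new) =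
  no-large-reach bounded nocop R′ (b ℤ.+ x ∷ B) (rec (ℕ.≤-reflexive (↭.↭-length p)))
    (there 0∈) (new ∷ inc) (λ r → lift (reach-resp-↭ p (reach-absorb b∈ r)))
    (All.tail (↭.All-resp-↭ (↭-sym p) n∤R))
    (subst (2 * n ≤_) (trans (cong (ℕ._+ length B) (sym (↭.↭-length p))) (sym (ℕ.+-suc _ _))) 2n≤)
-- Since `B` has at most `n` elements, at least `n` terms remain in `R`, enough for their gcd with
-- `n` to be 1. Then 1 is a period, `B` covers all residues, and `R` would have fewer than `n`
-- terms.
... | inj₂ closeds = ℕ.<⇒≱ (full⇒length< nocop closed1 0∈ lift n∤R) n≤R
  where
  n≤R : n ≤ length R
  n≤R = ℕ.+-cancelʳ-≤ n n (length R) (begin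
    n ℕ.+ n                ≡⟨ cong (n ℕ.+_) (ℕ.+-identityʳ n) ⟨
    2 * n                  ≤⟨ 2n≤ ⟩
    length R ℕ.+ length B  ≤⟨ ℕ.+-monoʳ-≤ (length R) (incongruent⇒length≤ inc) ⟩
    length R ℕ.+ n         ∎)
    where open ℕ.≤-Reasoning
  adm : Admissible n k R
  adm {T} T⊑R = lift (ℤ.0ℤ , T , 0∈ , T⊑R , sym (ℤ.+-identityˡ (sum T)))
  gcds≡1 : gcds n R ≡ 1
  gcds≡1 = no-common-divisor bounded nocop n∤R adm n≤R (gcds∣ n R) (gcds∣all n R)
  closed1 : ShiftClosed n B (+ 1)
  closed1 = subst (λ g → ShiftClosed n B (+ g)) gcds≡1 (closed-gcds closeds)

bounded : ∀ k n → Bounded k n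
bounded k = <-rec (Bounded k) λ n rec nocop R n∤R adm 2n≤ →
  no-large-reach rec nocop R [ ℤ.0ℤ ] (<-wellFounded (length R)) (here refl) ([] ∷ [])
    (λ { (_ , X , here refl , X⊑ , refl) n∣ →
       subst (_ ∣ℤ_) (sym (ℤ.+-identityˡ _)) (adm X⊑ (subst (_ ∣ℤ_) (ℤ.+-identityˡ _) n∣)) })
    n∤R 2n≤

-- Sums of lists

sum-++ : ∀ S T → sum (S ++ T) ≡ sum S ℤ.+ sum T
sum-++ []      T = sym (ℤ.+-identityˡ (sum T))
sum-++ (x ∷ S) T = trans (cong (λ t → x ℤ.+ t) (sum-++ S T)) (sym (ℤ.+-assoc x (sum S) (sum T)))

sum-↭ : S ↭ T → sum S ≡ sum T
sum-↭ = foldr-commMonoid (setoid ℤ) ℤ.+-0-isCommutativeMonoid ∘ ↭⇒↭ₛ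

-- The length restriction

suffixSums : List ℤ → List ℤ
suffixSums []      = [ ℤ.0ℤ ]
suffixSums (x ∷ T) = sum (x ∷ T) ∷ suffixSums T

length-suffixSums : ∀ T → length (suffixSums T) ≡ ℕ.suc (length T)
length-suffixSums []      = refl
length-suffixSums (_ ∷ T) = cong ℕ.suc (length-suffixSums T)

∈-suffixSums : ∀ T → z ∈ suffixSums T → ∃₂ λ X Y → T ≡ X ++ Y × sum Y ≡ z
∈-suffixSums []      (here refl) = [] , [] , refl , refl
∈-suffixSums (x ∷ T) (here refl) = [] , x ∷ T , refl , refl
∈-suffixSums (x ∷ T) (there z∈) with X , Y , refl , eq ← ∈-suffixSums T z∈ = x ∷ X , Y , refl , eq

ZeroSumBlock : ℕ → List ℤ → Set
ZeroSumBlock n T = ∃[ X ] ∃[ y ] ∃[ Y ] ∃[ Z ] T ≡ X ++ (y ∷ Y) ++ Z × + n ∣ℤ sum (y ∷ Y)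

block⊎incongruent : ∀ n T → ZeroSumBlock n T ⊎ Incongruent n (suffixSums T)
block⊎incongruent n []      = inj₂ ([] ∷ [])
block⊎incongruent n (x ∷ T) with block⊎incongruent n T
... | inj₁ (X , y , Y , Z , refl , n∣) = inj₁ (x ∷ X , y , Y , Z , refl , n∣)
... | inj₂ inc with any? (λ s → sum (x ∷ T) ≈? s [ n ]) (suffixSums T)
...   | no ¬hit = inj₂ (¬Any⇒All¬ _ ¬hit ∷ inc)
...   | yes hit
  with s , s∈ , p ← find hit
  with X , Y , refl , refl ← ∈-suffixSums T s∈
  = inj₁ ([] , x , X , Y , refl , +-≈⇒∣ (sum Y) (≈-trans (≈-reflexive sum≡) p))
  where
  sum≡ : sum Y ℤ.+ sum (x ∷ X) ≡ sum (x ∷ X ++ Y)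
  sum≡ = trans (ℤ.+-comm (sum Y) (sum (x ∷ X))) (sym (sum-++ (x ∷ X) Y))

-- There are more than `n` suffix sums, the empty one included, so two agree modulo `n`; their
-- difference is the sum of a block.
zeroSumBlock : .{{_ : NonZero n}} → n ≤ length T → ZeroSumBlock n T
zeroSumBlock {n} {T} n≤ with block⊎incongruent n T
... | inj₁ block = block
... | inj₂ inc = contradiction (ℕ.≤-trans (incongruent⇒length≤ inc) n≤)
                   (ℕ.<⇒≱ (ℕ.≤-reflexive (sym (length-suffixSums T))))

short⇒admissible : .{{_ : NonZero n}} →
  ¬ (∃[ T ] T ⊑ S × length T ≤ n × SumDivisibleByButNotBy n (n * k) T) → Admissible n k S
short⇒admissible {n} {S} {k} noShort {T} T⊑S = go T (<-wellFounded (length T)) T⊑S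
  where
  go : ∀ T → Acc ℕ._<_ (length T) → T ⊑ S → + n ∣ℤ sum T → + (n * k) ∣ℤ sum T
  go T (acc rec) T⊑S n∣T with length T ℕ.≤? n
  ... | yes ≤n with + (n * k) ℤ∣.∣? sum T
  ...   | yes nk∣ = nk∣
  ...   | no nk∤  = contradiction (T , T⊑S , ≤n , n∣T , nk∤) noShort
  go [] _ _ _ | no ≰n = contradiction ℕ.z≤n ≰n
  -- The block is sought in the tail, which still has `n` terms. This keeps `t` out of it, so both
  -- the block and its complement are nonempty and hence shorter than the whole.
  go (t ∷ T) (acc rec) T⊑S n∣T | no ≰n
    with X , y , Y , Z , refl , n∣Y ← zeroSumBlock {n} {T} (ℕ.s≤s⁻¹ (ℕ.≰⇒> ≰n))
    = subst (+ (n * k) ∣ℤ_) (sym sum≡) (ℤ∣.∣m∣n⇒∣m+n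
        (go (y ∷ Y) (rec Y<) (⊑-trans (t ∷ X ++ Z , ↭-sym move) T⊑S) n∣Y)
        (go (t ∷ X ++ Z) (rec XZ<) (⊑-trans (y ∷ Y , XZ-move) T⊑S)
          (ℤ∣.∣m+n∣m⇒∣n (subst (+ n ∣ℤ_) sum≡ n∣T) n∣Y)))
    where
    move : t ∷ X ++ (y ∷ Y) ++ Z ↭ (y ∷ Y) ++ t ∷ X ++ Z
    move = ↭.shifts (t ∷ X) (y ∷ Y)
    XZ-move : (t ∷ X ++ Z) ++ y ∷ Y ↭ t ∷ X ++ (y ∷ Y) ++ Z
    XZ-move = ↭-trans (↭.++-comm (t ∷ X ++ Z) (y ∷ Y)) (↭-sym move)
    sum≡ : sum (t ∷ X ++ (y ∷ Y) ++ Z) ≡ sum (y ∷ Y) ℤ.+ sum (t ∷ X ++ Z)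
    sum≡ = trans (sum-↭ move) (sum-++ (y ∷ Y) (t ∷ X ++ Z))
    len≡ : length (t ∷ X ++ (y ∷ Y) ++ Z) ≡ length (y ∷ Y) ℕ.+ length (t ∷ X ++ Z)
    len≡ = trans (↭.↭-length move) (length-++ (y ∷ Y))
    Y< : length (y ∷ Y) ℕ.< length (t ∷ X ++ (y ∷ Y) ++ Z)
    Y< = subst (length (y ∷ Y) ℕ.<_) (sym len≡) (ℕ.m<m+n _ ℕ.z<s)
    XZ< : length (t ∷ X ++ Z) ℕ.< length (t ∷ X ++ (y ∷ Y) ++ Z)
    XZ< = subst (length (t ∷ X ++ Z) ℕ.<_) (sym len≡) (ℕ.m<n+m _ ℕ.z<s)

-- All terms agree up to sign modulo n

-- As neither x nor y is 0 modulo n, failure of both alternatives makes 0, x, y, x + y distinct.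
-- With the other 2n - 4 terms they add up to exactly the 2n that `no-large-reach` forbids.
pair-± : .{{_ : NonZero n}} → NoCoprimeDivisor n k → All (λ x → ¬ + n ∣ℤ x) S → Admissible n k S →
  x ∷ y ∷ R ↭ S → length S ℕ.+ 2 ≡ 2 * n → y ≈ x [ n ] ⊎ y ≈ ℤ.- x [ n ]
pair-± {n} {k} {S} {x} {y} {R} nocop n∤S adm p len with y ≈? x [ n ] | y ≈? ℤ.- x [ n ]
... | yes y≈x | _         = inj₁ y≈x
... | no _    | yes y≈-x  = inj₂ y≈-x
... | no y≉x  | no y≉-x with n∤x ∷ n∤y ∷ n∤R ← ↭.All-resp-↭ (↭-sym p) n∤S =
  ⊥-elim (no-large-reach (λ {n′} _ → bounded k n′) nocop R pairSums (<-wellFounded _)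
    (there (there (there (here refl)))) inc lift n∤R 2n≤)
  where
  pairSums : List ℤ
  pairSums = y ℤ.+ x ∷ x ∷ y ∷ ℤ.0ℤ ∷ []
  x+y≈0⇒ : y ℤ.+ x ≈ ℤ.0ℤ [ n ] → y ≈ ℤ.- x [ n ]
  x+y≈0⇒ (mod q) = mod (subst (_ ∣ℤ_) (eq x y) q)
    where
    eq : ∀ x y → (y ℤ.+ x) ℤ.- ℤ.0ℤ ≡ y ℤ.- ℤ.- x
    eq = solve-∀
  inc : Incongruent n pairSums
  inc = ((λ q → n∤y (+-≈⇒∣ x (≈-trans (≈-reflexive (ℤ.+-comm x y)) q))) ∷
         (λ q → n∤x (+-≈⇒∣ y q)) ∷ (λ q → y≉-x (x+y≈0⇒ q)) ∷ []) ∷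
        ((λ q → y≉x (≈-sym q)) ∷ (λ q → n∤x (≈0⇒∣ q)) ∷ []) ∷
        ((λ q → n∤y (≈0⇒∣ q)) ∷ []) ∷ [] ∷ []
  lift : ∀ {z} → Reach pairSums R z → + n ∣ℤ z → + (n * k) ∣ℤ z
  lift (_ , X , here refl , X⊑ , refl) =
    subst (λ s → + n ∣ℤ s → + (n * k) ∣ℤ s) (eq x y (sum X))
      (adm (⊑-resp-↭ p (⊑-keep (⊑-keep X⊑))))
    where
    eq : ∀ x y s → x ℤ.+ (y ℤ.+ s) ≡ (y ℤ.+ x) ℤ.+ s
    eq = solve-∀
  lift (_ , X , there (here refl) , X⊑ , refl) = adm (⊑-resp-↭ p (⊑-keep (⊑-skip X⊑)))
  lift (_ , X , there (there (here refl)) , X⊑ , refl) = adm (⊑-resp-↭ p (⊑-skip (⊑-keep X⊑)))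
  lift (_ , X , there (there (there (here refl))) , X⊑ , refl) =
    subst (λ s → + n ∣ℤ s → + (n * k) ∣ℤ s) (sym (ℤ.+-identityˡ (sum X)))
      (adm (⊑-resp-↭ p (⊑-skip (⊑-skip X⊑))))
  2n≤ : 2 * n ≤ length R ℕ.+ 4
  2n≤ = ℕ.≤-reflexive (begin
    2 * n                        ≡⟨ len ⟨
    length S ℕ.+ 2               ≡⟨ cong (ℕ._+ 2) (↭.↭-length p) ⟨
    2 ℕ.+ length R ℕ.+ 2         ≡⟨ cong (ℕ._+ 2) (ℕ.+-comm 2 (length R)) ⟩
    length R ℕ.+ 2 ℕ.+ 2         ≡⟨ ℕ.+-assoc (length R) 2 2 ⟩
    length R ℕ.+ 4               ∎)
    where open ≡-Reasoning

all-± : .{{_ : NonZero n}} → NoCoprimeDivisor n k → All (λ y → ¬ + n ∣ℤ y) (x ∷ S) →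
  Admissible n k (x ∷ S) → length (x ∷ S) ℕ.+ 2 ≡ 2 * n →
  All (λ y → y ≈ x [ n ] ⊎ y ≈ ℤ.- x [ n ]) S
all-± {x = x} nocop n∤S adm len = All.tabulate λ y∈ →
  let X , Y , eq = ∈-∃++ y∈
  in pair-± nocop n∤S adm (prep x (↭-trans (↭-sym (↭.shift _ X Y)) (↭-reflexive (sym eq)))) len

-- All terms are ± x modulo `n`, so a common divisor of x and n divides every term.
coprime-term : .{{_ : NonZero n}} → NoCoprimeDivisor n k → All (λ y → ¬ + n ∣ℤ y) (x ∷ S) →
  Admissible n k (x ∷ S) → length (x ∷ S) ℕ.+ 2 ≡ 2 * n → n ≤ length (x ∷ S) →
  Coprime ℤ.∣ x ∣ n
coprime-term {n} {k} {x} {S} nocop n∤S adm len n≤ {d} (d∣x , d∣n) =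
  no-common-divisor (λ {n′} _ → bounded k n′) nocop n∤S adm n≤ d∣n
    (ℤ∣.∣ᵤ⇒∣ d∣x ∷ All.map d∣ (all-± nocop n∤S adm len))
  where
  d∣ : ∀ {y} → y ≈ x [ n ] ⊎ y ≈ ℤ.- x [ n ] → + d ∣ℤ y
  d∣ (inj₁ p) = ≈-∣ (≈-weaken d∣n p) (ℤ∣.∣ᵤ⇒∣ d∣x)
  d∣ (inj₂ p) = ≈-∣ (≈-weaken d∣n p) (ℤ∣.∣m⇒∣-m (ℤ∣.∣ᵤ⇒∣ d∣x))

-- Choosing congruent terms

⊑-++ : R ⊑ T → S ⊑ U → R ++ S ⊑ T ++ U
⊑-++ {R} {T} {S} {U} (X , p) (Y , q) = X ++ Y , ↭-trans shuffle (↭.++⁺ p q)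
  where
  shuffle : (R ++ S) ++ X ++ Y ↭ (R ++ X) ++ S ++ Y
  shuffle = ↭-trans (↭.++-assoc R S (X ++ Y))
    (↭-trans (↭.++⁺ˡ R (↭.shifts S X)) (↭-sym (↭.++-assoc R X (S ++ Y))))

∈⇒↭ : x ∈ S → ∃[ R ] x ∷ R ↭ S
∈⇒↭ x∈ with X , Y , eq ← ∈-∃++ x∈ = X ++ Y , ↭-trans (↭-sym (↭.shift _ X Y)) (↭-reflexive (sym eq))

take-⊑ : ∀ i S → take i S ⊑ S
take-⊑ i S = drop i S , ↭-reflexive (take++drop≡id i S)

length-take-≤ : ∀ {i} → i ≤ length S → length (take i S) ≡ i
length-take-≤ {S} {i} i≤ = trans (length-take i S) (ℕ.m≤n⇒m⊓n≡m i≤)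

sum-constant : All (λ x → x ≈ y [ N ]) S → sum S ≈ + length S ℤ.* y [ N ]
sum-constant []                         = ≈-refl
sum-constant {y} {S = x ∷ S} (x≈y ∷ ≈y) =
  ≈-trans (≈-+ x≈y (sum-constant ≈y)) (≈-reflexive (sym (ℤ.suc-* (+ length S) y)))

sum-constant-∣ : All (λ x → x ≈ y [ n ]) S → length S ≡ n → + n ∣ℤ sum S
sum-constant-∣ {y} {n} ≈y refl = ≈-∣ (sum-constant ≈y) (ℤ∣.∣m⇒∣m*n y ℤ∣.∣-refl)

coprime-≈ : x ≈ y [ n ] → Coprime ℤ.∣ x ∣ n → Coprime ℤ.∣ y ∣ n
coprime-≈ {n = n} x≈y cop {d} (d∣y , d∣n) =
  cop (ℤ∣.∣⇒∣ᵤ {+ d} (≈-∣ (≈-weaken d∣n x≈y) (ℤ∣.∣ᵤ⇒∣ d∣y)) , d∣n)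

-- The multiplicities

-- The sum of n such terms is nx modulo nk, so admissibility gives k | x. As x is coprime to n, so
-- is k, and then `nocop` applied to n itself yields n = 1.
few-equal : .{{_ : NonZero n}} → NoCoprimeDivisor n k → 1 ℕ.< n → Admissible n k S →
  Coprime ℤ.∣ x ∣ n → T ⊑ S → All (λ y → y ≈ x [ n * k ]) T → length T ℕ.< n
few-equal {n} {k} {S} {x} {T} nocop 1<n adm cop T⊑S ≈x with length T ℕ.<? n
... | yes < = <
... | no ≮ = contradiction n≡1 (ℕ.<⇒≢ 1<n ∘ sym)
  where
  len : length (take n T) ≡ n
  len = length-take-≤ (ℕ.≮⇒≥ ≮)
  nk∣ : + (n * k) ∣ℤ sum (take n T)
  nk∣ = adm (⊑-trans (take-⊑ n T) T⊑S)
    (sum-constant-∣ (take⁺ n (All.map (≈-weaken (ℕ∣.m∣m*n k)) ≈x)) len)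
  nk∣nx : + (n * k) ∣ℤ + n ℤ.* x
  nk∣nx = subst (λ l → + (n * k) ∣ℤ + l ℤ.* x) len (≈-∣ (≈-sym (sum-constant (take⁺ n ≈x))) nk∣)
  k∣x : k ∣ ℤ.∣ x ∣
  k∣x = ℕ∣.*-cancelˡ-∣ n (subst (n * k ∣_) (ℤ.abs-* (+ n) x) (ℤ∣.∣⇒∣ᵤ nk∣nx))
  n≡1 : n ≡ 1
  n≡1 = nocop ℕ∣.∣-refl (λ (d∣n , d∣k) → cop (ℕ∣.∣-trans d∣k k∣x , d∣n))

-- The two-term sum x + y is divisible by n, hence by nk.
opposite : Admissible n k S → T ++ U ↭ S → All (λ y → y ≈ z [ n ]) T → All (λ y → y ≈ ℤ.- z [ n ]) U →
  x ∈ T → y ∈ U → x ≈ ℤ.- y [ n * k ]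
opposite {n} {k} {S} {T} {U} {z} {x} {y} adm p ≈z ≈-z x∈ y∈ =
  mod (subst (_ ∣ℤ_) (eq x y) (adm xy⊑S (≈0⇒∣ (≈-trans
    (≈-+ (All.lookup ≈z x∈) (≈-+ (All.lookup ≈-z y∈) ≈-refl)) (≈-reflexive (cancel z))))))
  where
  xy⊑S : x ∷ y ∷ [] ⊑ S
  xy⊑S = ⊑-resp-↭ p (⊑-++ (∈⇒↭ x∈) (∈⇒↭ y∈))
  eq : ∀ x y → x ℤ.+ (y ℤ.+ ℤ.0ℤ) ≡ x ℤ.- ℤ.- y
  eq = solve-∀
  cancel : ∀ z → z ℤ.+ (ℤ.- z ℤ.+ ℤ.0ℤ) ≡ ℤ.0ℤ
  cancel = solve-∀

-- Here `r` counts the terms left after two of the 2n - 2 are removed; n - 1 ≤ 2n - 4 is where n ≥ 3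
-- enters.
n≤2n-3 : ∀ {n r} → 3 ≤ n → r ℕ.+ 4 ≡ 2 * n → n ∸ 1 ≤ r
n≤2n-3 {n} {r} 3≤n eq = ℕ.m≤n+o⇒m∸n≤o n 1 (ℕ.+-cancelʳ-≤ 3 n (1 ℕ.+ r) (begin
  n ℕ.+ 3          ≤⟨ ℕ.+-monoʳ-≤ n 3≤n ⟩
  n ℕ.+ n          ≡⟨ cong (n ℕ.+_) (ℕ.+-identityʳ n) ⟨
  2 * n            ≡⟨ eq ⟨
  r ℕ.+ 4          ≡⟨ ℕ.+-suc r 3 ⟩
  1 ℕ.+ r ℕ.+ 3    ∎))
  where open ℕ.≤-Reasoning

-- If some u lies in `U`, every term of `T` is opposite to u, so all are congruent modulo nk and
-- `few-equal` applies.
few-congruent : .{{_ : NonZero n}} → NoCoprimeDivisor n k → 3 ≤ n → Admissible n k S →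
  length S ℕ.+ 2 ≡ 2 * n → Coprime ℤ.∣ z ∣ n → ∀ T U → T ++ U ↭ S →
  All (λ y → y ≈ z [ n ]) T → All (λ y → y ≈ ℤ.- z [ n ]) U → length T ℕ.< n
few-congruent {n} _ _ _ _ _ [] _ _ _ _ = ℕ.>-nonZero⁻¹ n
few-congruent nocop 3≤n adm len cop T (u ∷ U) p ≈z ≈-z@(u≈-z ∷ _) =
  few-equal nocop (ℕ.<-trans ℕ.≤-refl 3≤n) adm (coprime-≈ z≈-u cop) (u ∷ U , p)
    (All.tabulate (λ t∈ → opposite adm p ≈z ≈-z t∈ (here refl)))
  where
  z≈-u = ≈-trans (≈-reflexive (sym (ℤ.neg-involutive _))) (≈-neg (≈-sym u≈-z))
-- Here S = T, so any n − 1 further terms complete both t and t′ to a multiple of n.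
few-congruent {n} {k} {S} {z} nocop 3≤n adm len cop (t ∷ T) [] p (t≈z ∷ ≈z) _ =
  few-equal nocop (ℕ.<-trans ℕ.≤-refl 3≤n) adm (coprime-≈ (≈-sym t≈z) cop) ([] , p)
    (≈-refl ∷ All.tabulate equal)
  where
  equal : ∀ {t′} → t′ ∈ T → t′ ≈ t [ n * k ]
  equal {t′} t′∈ with R , q ← ∈⇒↭ t′∈ with t′≈z ∷ R≈z ← ↭.All-resp-↭ (↭-sym q) ≈z =
    mod (subst (_ ∣ℤ_) (eq t′ t (sum Q)) (ℤ∣.∣m∣n⇒∣m-n (adm (⊑-resp-↭ r (⊑-skip t′Q⊑)) (n∣ t′≈z))
                                           (adm (⊑-resp-↭ r (⊑-keep Q⊑)) (n∣ t≈z))))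
    where
    Q = take (n ∸ 1) R
    r : t ∷ t′ ∷ R ↭ S
    r = ↭-trans (prep t q) (↭-trans (↭-sym (↭.++-identityʳ (t ∷ T))) p)
    t′Q⊑ : t′ ∷ Q ⊑ t′ ∷ R
    t′Q⊑ = ⊑-keep (take-⊑ (n ∸ 1) R)
    Q⊑ : Q ⊑ t′ ∷ R
    Q⊑ = ⊑-skip (take-⊑ (n ∸ 1) R)
    n≤R : n ∸ 1 ≤ length R
    n≤R = n≤2n-3 3≤n (trans (ℕ.+-suc (length R) 3) (trans (cong ℕ.suc (ℕ.+-suc (length R) 2))
            (trans (cong (ℕ._+ 2) (↭.↭-length r)) len)))
    n∣ : ∀ {y} → y ≈ z [ n ] → + n ∣ℤ sum (y ∷ Q)
    n∣ y≈z = sum-constant-∣ (y≈z ∷ take⁺ (n ∸ 1) R≈z)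
      (trans (cong ℕ.suc (length-take-≤ n≤R)) (ℕ.suc-pred n))
    eq : ∀ x y s → (x ℤ.+ s) ℤ.- (y ℤ.+ s) ≡ x ℤ.- y
    eq = solve-∀

-- The two halves of an extremal sequence

separate : ∀ {A B : ℤ → Set} → All (λ x → A x ⊎ B x) S →
           ∃[ T ] ∃[ U ] T ++ U ↭ S × All A T × All B U
separate []             = [] , [] , ↭-refl , [] , []
separate (inj₁ a ∷ abs) with T , U , p , as , bs ← separate abs = _ , U , prep _ p , a ∷ as , bs
separate (inj₂ b ∷ abs) with T , U , p , as , bs ← separate abs =
  T , _ , ↭-trans (↭.shift _ T U) (prep _ p) , as , b ∷ bs

-- The structure with a single residue `g` in place of the pair c, d. It is established for `N`
-- equal to `n` first and then lifted to `n * k`.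
record Halves (n N : ℕ) (S : List ℤ) : Set where
  field
    {g}      : ℤ
    {P M}    : List ℤ
    coprime  : Coprime ℤ.∣ g ∣ n
    split    : P ++ M ↭ S
    length-P : length P ≡ n ∸ 1
    length-M : length M ≡ n ∸ 1
    P≈g      : All (λ y → y ≈ g [ N ]) P
    M≈-g     : All (λ y → y ≈ ℤ.- g [ N ]) M

both-maximal : ∀ {a b} → a ℕ.< n → b ℕ.< n → a ℕ.+ b ℕ.+ 2 ≡ 2 * n → b ≡ n ∸ 1
both-maximal {n} {a} {b} a<n b<n eq = cong ℕ.pred (ℕ.≤-antisym b<n (ℕ.+-cancelˡ-≤ n n (ℕ.suc b) (begin
  n ℕ.+ n                ≡⟨ cong (n ℕ.+_) (ℕ.+-identityʳ n) ⟨
  2 * n                  ≡⟨ eq ⟨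
  a ℕ.+ b ℕ.+ 2          ≡⟨ ℕ.+-suc (a ℕ.+ b) 1 ⟩
  ℕ.suc (a ℕ.+ b ℕ.+ 1)  ≡⟨ cong ℕ.suc (trans (ℕ.+-assoc a b 1) (cong (a ℕ.+_) (ℕ.+-comm b 1))) ⟩
  ℕ.suc a ℕ.+ ℕ.suc b    ≤⟨ ℕ.+-monoˡ-≤ (ℕ.suc b) a<n ⟩
  n ℕ.+ ℕ.suc b          ∎)))
  where open ℕ.≤-Reasoning

halves-mod-n : .{{_ : NonZero n}} → NoCoprimeDivisor n k → 1 ℕ.< n → All (λ y → ¬ + n ∣ℤ y) S →
  Admissible n k S → length S ℕ.+ 2 ≡ 2 * n → Halves n n S
halves-mod-n {n} {S = []} _ 1<n _ _ len =
  contradiction (ℕ.*-cancelˡ-≡ 1 n 2 len) (ℕ.<⇒≢ 1<n)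
halves-mod-n {n} {k} {S = x ∷ S} nocop 1<n n∤S adm len with n ℕ.≟ 2
... | no n≢2 with T , U , p , ≈x , ≈-x ← separate (all-± nocop n∤S adm len) = record
  { coprime  = cop
  ; split    = prep x p
  ; length-P = both-maximal U< T< (trans (cong (ℕ._+ 2) (ℕ.+-comm (length U) (length (x ∷ T)))) lens)
  ; length-M = both-maximal T< U< lens
  ; P≈g      = ≈-refl ∷ ≈x
  ; M≈-g     = ≈-x
  }
  where
  2<n = ℕ.≤∧≢⇒< 1<n (n≢2 ∘ sym)
  n≤S : n ≤ length (x ∷ S)
  n≤S = ℕ.+-cancelʳ-≤ 2 n _ (begin
    n ℕ.+ 2                  ≤⟨ ℕ.+-monoʳ-≤ n 1<n ⟩
    n ℕ.+ n                  ≡⟨ cong (n ℕ.+_) (ℕ.+-identityʳ n) ⟨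
    2 * n                    ≡⟨ len ⟨
    length (x ∷ S) ℕ.+ 2     ∎)
    where open ℕ.≤-Reasoning
  cop : Coprime ℤ.∣ x ∣ n
  cop = coprime-term nocop n∤S adm len n≤S
  T< : length (x ∷ T) ℕ.< n
  T< = few-congruent nocop 2<n adm len cop (x ∷ T) U (prep x p) (≈-refl ∷ ≈x) ≈-x
  U< : length U ℕ.< n
  U< = few-congruent {z = ℤ.- x} nocop 2<n adm len (subst (λ a → Coprime a n) (sym (ℤ.∣-i∣≡∣i∣ x)) cop)
    U (x ∷ T) (↭-trans (↭.++-comm U (x ∷ T)) (prep x p)) ≈-x
    (All.map (λ q → ≈-trans q (≈-reflexive (sym (ℤ.neg-involutive x)))) (≈-refl ∷ ≈x))
  lens : length (x ∷ T) ℕ.+ length U ℕ.+ 2 ≡ 2 * n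
  lens = trans (cong (ℕ._+ 2) (trans (sym (length-++ (x ∷ T))) (↭.↭-length (prep x p)))) len
-- For n = 2 there are too few terms for `few-congruent`, but `S` has just two terms and signs do
-- not matter modulo 2.
halves-mod-n {k = k} {S = x ∷ S} nocop 1<n n∤S adm len | yes refl with S | len
... | _ ∷ _ ∷ R | len≡4 =
  contradiction (sym len≡4) (ℕ.<⇒≢ (ℕ.s≤s (ℕ.s≤s (ℕ.s≤s (ℕ.m≤n+m 2 (length R))))))
... | y ∷ [] | _ = record
  { coprime  = coprime-term nocop n∤S adm refl ℕ.≤-refl
  ; split    = ↭-refl {x = x ∷ y ∷ []}
  ; length-P = refl
  ; length-M = refl
  ; P≈g      = ≈-refl ∷ []
  ; M≈-g     = y≈-x (All.head (all-± nocop n∤S adm refl)) ∷ []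
  }
  where
  y≈-x : y ≈ x [ 2 ] ⊎ y ≈ ℤ.- x [ 2 ] → y ≈ ℤ.- x [ 2 ]
  y≈-x (inj₁ y≈x) = ≈-trans y≈x (mod (divides x (eq x)))
    where
    eq : ∀ x → x ℤ.- ℤ.- x ≡ x ℤ.* + 2
    eq = solve-∀
  y≈-x (inj₂ y≈-x) = y≈-x

-- As n > 1, there are t in `P` and u in `M`. The new `g` is -u: every term of `P` is opposite to u,
-- and every term of `M` is opposite to t, hence congruent to u.
halves-mod-nk : 1 ℕ.< n → Admissible n k S → Halves n n S → Halves n (n * k) S
halves-mod-nk 1<n adm halves with Halves.P halves in P≡ | Halves.M halves in M≡
... | [] | _ = contradiction (ℕ.m∸n≡0⇒m≤n (trans (sym (Halves.length-P halves)) (cong length P≡))) (ℕ.<⇒≱ 1<n)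
... | _ | [] = contradiction (ℕ.m∸n≡0⇒m≤n (trans (sym (Halves.length-M halves)) (cong length M≡))) (ℕ.<⇒≱ 1<n)
... | t ∷ _ | u ∷ _ = record
  { coprime  = coprime-≈ (≈-trans (≈-reflexive (sym (ℤ.neg-involutive g))) (≈-neg (≈-sym (All.lookup M≈-g u∈)))) coprime
  ; split    = split
  ; length-P = length-P
  ; length-M = length-M
  ; P≈g      = All.tabulate (λ t′∈ → opp t′∈ u∈)
  ; M≈-g     = All.tabulate (λ u′∈ → ≈-trans (flip-sign (opp t∈ u′∈)) (≈-neg (opp t∈ u∈)))
  }
  where
  open Halves halves
  t∈ : t ∈ P
  t∈ = subst (t ∈_) (sym P≡) (here refl)
  u∈ : u ∈ M
  u∈ = subst (u ∈_) (sym M≡) (here refl)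
  opp : ∀ {x y} → x ∈ P → y ∈ M → x ≈ ℤ.- y [ _ ]
  opp = opposite adm split P≈g M≈-g
  flip-sign : ∀ {x y} → x ≈ ℤ.- y [ N ] → y ≈ ℤ.- x [ N ]
  flip-sign {y = y} p = ≈-trans (≈-reflexive (sym (ℤ.neg-involutive y))) (≈-neg (≈-sym p))
-- The form d(nk/m) + cm of the common residue

-- Multiply um + vN = 1 by x. A common divisor of c = xu and n also divides N, hence x.
coprime-representation : ∀ m N → Coprime m N → n ∣ N → Coprime ℤ.∣ x ∣ n →
  ∃₂ λ c d → ℤCoprime c (+ n) × x ≡ d ℤ.* + N ℤ.+ c ℤ.* + m
coprime-representation {n} {x} m N copN n∣N copx with u , v , eq ← bézout m N =
  x ℤ.* u , x ℤ.* v , copc , x≡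
  where
  x≡ : x ≡ (x ℤ.* v) ℤ.* + N ℤ.+ (x ℤ.* u) ℤ.* + m
  x≡ = begin
    x                                              ≡⟨ ℤ.*-identityʳ x ⟨
    x ℤ.* + 1                                      ≡⟨ cong (λ g → x ℤ.* + g) (Coprime.coprime⇒gcd≡1 copN) ⟨
    x ℤ.* + gcd m N                                ≡⟨ cong (λ g → x ℤ.* g) eq ⟩
    x ℤ.* (u ℤ.* + m ℤ.+ v ℤ.* + N)                ≡⟨ expand x u v (+ m) (+ N) ⟩
    (x ℤ.* v) ℤ.* + N ℤ.+ (x ℤ.* u) ℤ.* + m        ∎
    where
    open ≡-Reasoning
    expand : ∀ x u v m N → x ℤ.* (u ℤ.* m ℤ.+ v ℤ.* N) ≡ (x ℤ.* v) ℤ.* N ℤ.+ (x ℤ.* u) ℤ.* m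
    expand = solve-∀
  copc : ℤCoprime (x ℤ.* u) (+ n)
  copc {e} (e∣c , e∣n) = copx (ℤ∣.∣⇒∣ᵤ {+ e} (subst (+ e ∣ℤ_) (sym x≡) (ℤ∣.∣m∣n⇒∣m+n
    (ℤ∣.∣n⇒∣m*n (x ℤ.* v) (ℤ∣.∣ᵤ⇒∣ (ℕ∣.∣-trans e∣n n∣N)))
    (ℤ∣.∣m⇒∣m*n {m = x ℤ.* u} (+ m) (ℤ∣.∣ᵤ⇒∣ e∣c)))) , e∣n)

-- A common divisor e of the form and n divides N, hence cm; being coprime to m, it divides c.
representation-coprime : ∀ m N c d → Coprime m n → n ∣ N → ℤCoprime c (+ n) →
  Coprime ℤ.∣ d ℤ.* + N ℤ.+ c ℤ.* + m ∣ n
representation-coprime {n} m N c d copm n∣N copc {e} (e∣ , e∣n) = copc (e∣c , e∣n)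
  where
  e∣cm : e ∣ m * ℤ.∣ c ∣
  e∣cm = subst (e ∣_) (trans (ℤ.abs-* c (+ m)) (ℕ.*-comm ℤ.∣ c ∣ m)) (ℤ∣.∣⇒∣ᵤ {+ e}
    (ℤ∣.∣m+n∣m⇒∣n {m = d ℤ.* + N} (ℤ∣.∣ᵤ⇒∣ e∣)
      (ℤ∣.∣n⇒∣m*n d (ℤ∣.∣ᵤ⇒∣ (ℕ∣.∣-trans e∣n n∣N)))))
  e∣c : e ∣ ℤ.∣ c ∣
  e∣c = coprime-divisor (λ (f∣e , f∣m) → copm (f∣m , ℕ∣.∣-trans f∣e e∣n)) e∣cm

-- Sums over the two halves

⊑-uncons : ∀ X → X ⊑ x ∷ S → X ⊑ S ⊎ (∃[ Y ] X ↭ x ∷ Y × Y ⊑ S)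
⊑-uncons X (U , p) with ∈-++⁻ X (↭.∈-resp-↭ (↭-sym p) (here refl))
... | inj₁ x∈X with Y , q ← ∈⇒↭ x∈X =
  inj₂ (Y , ↭-sym q , U , ↭.drop-∷ (↭-trans (↭.++⁺ʳ U q) p))
... | inj₂ x∈U with V , q ← ∈⇒↭ x∈U =
  inj₁ (V , ↭.drop-∷ (↭-trans (↭-sym (↭.shift _ X V)) (↭-trans (↭.++⁺ˡ X q) p)))

sum-split : ∀ T → All (λ y → y ≈ z [ N ]) T → ∀ X → X ⊑ T ++ U →
  ∃[ a ] ∃[ Y ] a ≤ length T × Y ⊑ U × sum X ≈ + a ℤ.* z ℤ.+ sum Y [ N ]
sum-split []      _          X X⊑ = 0 , X , ℕ.z≤n , X⊑ , ≈-reflexive (sym (ℤ.+-identityˡ (sum X)))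
sum-split {z} (x ∷ T) (x≈z ∷ ≈z) X X⊑ with ⊑-uncons X X⊑
... | inj₁ X⊑′ with a , Y , a≤ , Y⊑ , p ← sum-split T ≈z X X⊑′ = a , Y , ℕ.m≤n⇒m≤1+n a≤ , Y⊑ , p
... | inj₂ (X′ , q , X′⊑) with a , Y , a≤ , Y⊑ , p ← sum-split T ≈z X′ X′⊑ =
  ℕ.suc a , Y , ℕ.s≤s a≤ , Y⊑ ,
  ≈-trans (≈-reflexive (sum-↭ q)) (≈-trans (≈-+ x≈z p) (≈-reflexive (eq (+ a) z (sum Y))))
  where
  eq : ∀ a z s → z ℤ.+ (a ℤ.* z ℤ.+ s) ≡ (+ 1 ℤ.+ a) ℤ.* z ℤ.+ s
  eq = solve-∀

sum-halves : ∀ T U → All (λ y → y ≈ z [ N ]) T → All (λ y → y ≈ ℤ.- z [ N ]) U → R ⊑ T ++ U →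
  ∃₂ λ a b → a ≤ length T × b ≤ length U × sum R ≈ (+ a ℤ.- + b) ℤ.* z [ N ]
sum-halves {z} {R = X} T U ≈z ≈-z X⊑
  with a , Y , a≤ , Y⊑ , p ← sum-split T ≈z X X⊑
  -- Reading `U` as `U ++ []` lets `sum-split` apply a second time, with only an empty rest.
  with b , Z , b≤ , (V , Z⊑[]) , q ← sum-split U ≈-z Y (⊑-resp-↭ (↭-sym (↭.++-identityʳ U)) Y⊑)
  with refl ← ++-conicalˡ Z V (↭.↭-empty-inv Z⊑[])
  = a , b , a≤ , b≤ , ≈-trans p (≈-trans (≈-+ (≈-refl {+ a ℤ.* z}) q) (≈-reflexive (eq (+ a) (+ b) z)))
  where
  eq : ∀ a b z → a ℤ.* z ℤ.+ (b ℤ.* (ℤ.- z) ℤ.+ ℤ.0ℤ) ≡ (a ℤ.- b) ℤ.* z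
  eq = solve-∀

small-difference : ∀ {a b} → a ℕ.< n → b ℕ.< n → n ∣ ℤ.∣ + a ℤ.- + b ∣ → + a ℤ.- + b ≡ ℤ.0ℤ
small-difference {n} {a} {b} a< b< n∣ with ℤ.∣ + a ℤ.- + b ∣ in eq
... | 0         = ℤ.∣i∣≡0⇒i≡0 eq
... | ℕ.suc e = contradiction (ℕ∣.∣⇒≤ n∣) (ℕ.<⇒≱ (begin-strict
  ℕ.suc e             ≡⟨ eq ⟨
  ℤ.∣ + a ℤ.- + b ∣   ≡⟨ cong ℤ.∣_∣ (ℤ.m-n≡m⊖n a b) ⟩
  ℤ.∣ a ℤ.⊖ b ∣       ≤⟨ ℤ.∣m⊝n∣≤m⊔n a b ⟩
  a ℕ.⊔ b             <⟨ ℕ.⊔-lub a< b< ⟩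
  n                   ∎))
  where open ℕ.≤-Reasoning

-- A subsequence with a terms from `P` and b from `M` has sum (a - b)g modulo nk. If n divides it, n
-- divides a - b, since g is coprime to n. But |a - b| < n, so a = b and the sum is 0 modulo nk.
halves⇒admissible : .{{_ : NonZero n}} → Halves n (n * k) S → Admissible n k S
halves⇒admissible {n} {k} halves {X} X⊑S n∣X = result
  where
  open Halves halves
  sums = sum-halves P M P≈g M≈-g (⊑-resp-↭ (↭-sym split) X⊑S)
  a = proj₁ sums
  b = proj₁ (proj₂ sums)
  X≈ : sum X ≈ (+ a ℤ.- + b) ℤ.* g [ n * k ]
  X≈ = proj₂ (proj₂ (proj₂ (proj₂ sums)))
  bound : ∀ {i l} → i ≤ l → l ≡ n ∸ 1 → i ℕ.< n
  bound i≤ refl = subst (_ ℕ.<_) (ℕ.suc-pred n) (ℕ.s≤s i≤)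
  n∣ab : n ∣ ℤ.∣ + a ℤ.- + b ∣
  n∣ab = coprime-divisor (Coprime.sym coprime) (subst (n ∣_)
    (trans (ℤ.abs-* (+ a ℤ.- + b) g) (ℕ.*-comm ℤ.∣ + a ℤ.- + b ∣ ℤ.∣ g ∣))
    (ℤ∣.∣⇒∣ᵤ (≈-∣ (≈-sym (≈-weaken (ℕ∣.m∣m*n k) X≈)) n∣X)))
  a≡b : + a ℤ.- + b ≡ ℤ.0ℤ
  a≡b = small-difference (bound (proj₁ (proj₂ (proj₂ sums))) length-P)
          (bound (proj₁ (proj₂ (proj₂ (proj₂ sums)))) length-M) n∣ab
  result : + (n * k) ∣ℤ sum X
  result = ≈0⇒∣ (≈-trans X≈ (≈-reflexive (cong (ℤ._* g) a≡b)))

-- Radicals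

prime∣rad : .{{_ : NonZero n}} → ∀ {p} → Prime p → p ∣ n → p ∣ rad n
prime∣rad {n} pp p∣n = ∈⇒∣product (∈-filter⁺ (λ p → prime? p ×-dec (p ℕ∣.∣? n))
  (∈-upTo⁺ (ℕ.s≤s (ℕ∣.∣⇒≤ p∣n))) (pp , p∣n))

prime∣rad⁻ : ∀ n {p} → Prime p → p ∣ rad n → p ∣ n
prime∣rad⁻ n {p} pp p∣ = proj₂ (proj₂ (∈-filter⁻ dec {xs = upTo (ℕ.suc n)}
  (factorisationHasAllPrimeFactors pp p∣ (All.map proj₁ (all-filter dec (upTo (ℕ.suc n)))))))
  where dec = λ p → prime? p ×-dec (p ℕ∣.∣? n)

-- If j were not 1, a prime factor of it would divide n and so k, against coprimality.
primes-divide : .{{_ : NonZero n}} → (∀ {p} → Prime p → p ∣ n → p ∣ k) → NoCoprimeDivisor n k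
primes-divide {n} prime {j} j∣n cop with factorise j {{j≢0}}
  where
  j≢0 : NonZero j
  j≢0 = ℕ.≢-nonZero λ { refl → ℕ.≢-nonZero⁻¹ n (ℕ∣.0∣⇒≡0 j∣n) }
... | record { factors = []     ; isFactorisation = eq } = eq
... | record { factors = p ∷ ps ; isFactorisation = refl ; factorsPrime = pp ∷ _ } =
  contradiction (subst Prime (cop (p∣j , prime pp (ℕ∣.∣-trans p∣j j∣n))) pp) ¬prime[1]
  where p∣j = ℕ∣.m∣m*n (product ps)

rad≡⇒noCoprimeDivisor : .{{_ : NonZero n}} → rad k ≡ rad n → NoCoprimeDivisor n k
rad≡⇒noCoprimeDivisor {n} {k} eq = primes-divide λ pp p∣n →
  prime∣rad⁻ k pp (subst (_ ∣_) (sym eq) (prime∣rad pp p∣n))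

1<rad⇒1< : .{{_ : NonZero n}} → rad n > 1 → n > 1
1<rad⇒1< {1}                   1<1 = contradiction 1<1 (ℕ.<-irrefl refl)
1<rad⇒1< {ℕ.suc (ℕ.suc _)} _   = ℕ.s≤s (ℕ.s≤s ℕ.z≤n)

-- Halves modulo nk and the required structure

module _ (n k m : ℕ) .{{_ : NonZero n}} .{{_ : NonZero m}} (m∣k : m ∣ k)
         (copq : Coprime m (k / m)) (nocop : NoCoprimeDivisor n (k / m)) where

  private
    nq≡ : n * k / m ≡ n * (k / m)
    nq≡ = *-/-assoc n m∣k

    n∣nq : n ∣ n * k / m
    n∣nq = subst (n ∣_) (sym nq≡) (ℕ∣.m∣m*n (k / m))

    copn : Coprime m n
    -- A divisor of m is coprime to k/m, so one that also divides n must be 1.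
    copn (e∣m , e∣n) = nocop e∣n (λ (f∣e , f∣q) → copq (ℕ∣.∣-trans f∣e e∣m , f∣q))

    copnq : Coprime m (n * k / m)
    copnq (e∣m , e∣nq) = copq (e∣m , coprime-divisor
      (λ (f∣e , f∣n) → copn (ℕ∣.∣-trans f∣e e∣m , f∣n)) (subst (_ ∣_) nq≡ e∣nq))

    neg-form : ∀ c d N m → ℤ.- (d ℤ.* N ℤ.+ c ℤ.* m) ≡ (ℤ.- d) ℤ.* N ℤ.- c ℤ.* m
    neg-form = solve-∀

  halves⇒structure : Halves n (n * k) S → HasStructure n k m S
  halves⇒structure halves =
    let c , d , copc , eq = coprime-representation m (n * k / m) copnq n∣nq coprime in
    c , d , copc , P , M , split , length-P , length-M ,
    All.map (λ p → ∣-diff (≈-trans p (≈-reflexive eq))) P≈g ,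
    All.map (λ p → ∣-diff (≈-trans p (≈-reflexive
      (trans (cong ℤ.-_ eq) (neg-form c d (+ (n * k / m)) (+ m)))))) M≈-g
    where open Halves halves

  structure⇒halves : HasStructure n k m S → Halves n (n * k) S
  structure⇒halves (c , d , copc , P , M , split , length-P , length-M , P≡ , M≡) = record
    { coprime  = representation-coprime m (n * k / m) c d copn n∣nq copc
    ; split    = split
    ; length-P = length-P
    ; length-M = length-M
    ; P≈g      = All.map mod P≡
    ; M≈-g     = All.map (λ p → ≈-trans (mod p)
                   (≈-reflexive (sym (neg-form c d (+ (n * k / m)) (+ m))))) M≡
    }

theorem1p3 : (n k m : ℕ) .{{_ : NonZero n}} .{{_ : NonZero k}} .{{_ : NonZero m}} →
    m ∣ k → gcd m (k / m) ≡ 1 → rad (k / m) ≡ rad n → rad n > 1 →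
    (S : List ℤ) → length S ≡ 2 * n ∸ 2 → All (λ x → ¬ (+ n ∣ℤ x)) S →
    ((¬ (∃[ T ] T ⊑ S × length T ≤ n × SumDivisibleByButNotBy n (n * k) T)) ⇔ HasStructure n k m S)
    × (HasStructure n k m S → ¬ (∃[ T ] T ⊑ S × SumDivisibleByButNotBy n (n * k) T))
theorem1p3 n k m m∣k gcd≡1 rad≡ 1<rad S len n∤S =
  mk⇔ noShort⇒structure (λ h (T , T⊑S , _ , bad) → structure⇒none h (T , T⊑S , bad)) ,
  structure⇒none
  where
  1<n : n > 1
  1<n = 1<rad⇒1< 1<rad
  copq : Coprime m (k / m)
  copq = Coprime.gcd≡1⇒coprime gcd≡1
  nocop-q : NoCoprimeDivisor n (k / m)
  nocop-q = rad≡⇒noCoprimeDivisor rad≡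
  -- Coprimality to k passes to its divisor k/m. The arguments on sequences use k, the passage to c
  -- and d uses k/m.
  nocop : NoCoprimeDivisor n k
  nocop j∣n cop = nocop-q j∣n (λ (e∣j , e∣q) → cop (e∣j , ℕ∣.∣-trans e∣q (ℕ∣.m/n∣m m∣k)))
  len+2 : length S ℕ.+ 2 ≡ 2 * n
  len+2 = trans (cong (ℕ._+ 2) len) (ℕ.m∸n+n≡m (ℕ.*-monoʳ-≤ 2 (ℕ.<⇒≤ 1<n)))
  structure⇒none : HasStructure n k m S → ¬ (∃[ T ] T ⊑ S × SumDivisibleByButNotBy n (n * k) T)
  structure⇒none h (T , T⊑S , n∣T , nk∤T) =
    nk∤T (halves⇒admissible (structure⇒halves n k m m∣k copq nocop-q h) T⊑S n∣T)
  noShort⇒structure : ¬ (∃[ T ] T ⊑ S × length T ≤ n × SumDivisibleByButNotBy n (n * k) T) →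
                      HasStructure n k m S
  noShort⇒structure noShort = halves⇒structure n k m m∣k copq nocop-q
    (halves-mod-nk 1<n adm (halves-mod-n nocop 1<n n∤S adm len+2))
    where adm = short⇒admissible noShort
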